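{- Let $\mathbf{C}$ be the natural deduction system described in the context. For any deduction in $\mathbf{C}$, there is a deduction in $\mathbf{C}$ in normal form of the same conclusion from the same undischarged assumptions.
   Context: Formulas are built from atomic formulas (formulas containing no connective) by the connectives $\neg$ (unary), $\supset$, $\land$, $\lor$. Deductions in $\mathbf{C}$ are trees of formula occurrences whose leaves are assumptions; each assumption belongs to an assumption class marked by a number, and a rule discharging class $i$ (written $[X]^i$) discharges all assumptions of that class above the indicated premise. A single assumption $A$ is a deduction of $A$ from $A$. Rules ($C$ arbitrary): $\land I$: from $A$, $B$, and a deduction of $C$ from $[A\land B]$, infer $C$. $\land E$: from $A\land B$ and a deduction of $C$ from $[A]$, $[B]$, infer $C$. $\lor I$: from $A$ (or from $B$) and a deduction of $C$ from $[A\lor B]$, infer $C$. $\lor E$: from $A\lor B$, a deduction of $C$ from $[A]$, and a deduction of $C$ from $[B]$, infer $C$. $\supset I$: from $B$ and a deduction of $C$ from $[A\supset B]$, infer $C$. $TR$ (an introduction rule for $\supset$): from a deduction of $C$ from $[A]$ and a deduction of $C$ from $[A\supset B]$, infer $C$. $\supset E$: from $A\supset B$, $A$, and a deduction of $C$ from $[B]$, infer $C$. $\neg I$: from a deduction of $C$ from $[A]$ and a deduction of $C$ from $[\neg A]$, infer $C$. $\neg E$: from $\neg A$ and $A$, infer $C$. Introduction rules: $\land I,\lor I,\supset I,TR,\neg I$; elimination rules: $\land E,\lor E,\supset E,\neg E$. In elimination rules $A\land B, A\lor B, A\supset B,\neg A$ are the major premises; premises in the place of $C$ (in any rule) are arbitrary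 premises; the discharged $A\land B$, $A\lor B$, $A\supset B$ (in $\supset I$ and $TR$), $\neg A$ (in $\neg I$) are the major assumptions discharged by the introduction rule. Convention: there is no vacuous discharge above arbitrary premises (every discharge in a rule application above an arbitrary premise discharges at least one assumption occurrence, except that $\land E$ may discharge only one of $A$, $B$). A maximal formula is an occurrence of a formula with main connective $\ast$ that is both the major premise of an application of $\ast E$ and the major assumption discharged by an application of $\ast I$ (or of $TR$ when $\ast$ is $\supset$). A segment is a sequence $C_1,\dots,C_n$ of occurrences of the same formula such that for all $i<n$, $C_i$ is an arbitrary premise of a rule application whose conclusion is $C_{i+1}$, $C_n$ is not an arbitrary premise of any rule application, and either $n>1$, or $n\ge 1$ and $C_1$ is the conclusion of an application of $\neg E$. A maximal segment is a segment whose last formula is the major premise of an elimination rule. A deduction is in normal form if it contains neither maximal formulas nor maximal segments.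
   Formalization: "The same undischarged assumptions" is taken as: every undischarged assumption of the normal deduction is one of the original; exact equality fails, e.g. for A inferred from atoms A, B by ∧I and then ∧E discharging only A, where B must disappear. -}

module Defs where

open import Data.Nat using (ℕ; _<_)
open import Data.Bool using (Bool; true; false)
open import Data.List using (List; _∷_)
open import Data.List.Membership.Propositional using (_∈_)
open import Data.List.Relation.Unary.Any using (here; there; index)
open import Data.Product using (Σ; _×_)
open import Data.Sum using (_⊎_)
open import Data.Unit using (⊤)
open import Relation.Nullary using (¬_)
open import Relation.Binary.PropositionalEquality using (_≡_; refl)

infixr 6 _∧_ _∨_
infixr 5 _⊃_

data Form : Set where
  atom : ℕ → Form
  ¬'_  : Form → Form
  _⊃_  : Form → Form → Form
  _∧_  : Form → Form → Form
  _∨_  : Form → Form → Form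

-- Deductions of system C.
-- Ded Γ C : deductions of conclusion C whose undischarged assumptions
-- belong to the assumption classes listed in Γ (a class = a position
-- in Γ, de Bruijn style).  A rule discharging class i adds a new
-- position to the context of the premise(s) above which it discharges.
-- Assumption occurrences are leaves 'ass x' with x : A ∈ Γ.

data Ded (Γ : List Form) : Form → Set where
  ass  : ∀ {A} → A ∈ Γ → Ded Γ A
  ∧I   : ∀ {A B C} → Ded Γ A → Ded Γ B → Ded ((A ∧ B) ∷ Γ) C → Ded Γ C
  ∧E   : ∀ {A B C} → Ded Γ (A ∧ B) → Ded (A ∷ B ∷ Γ) C → Ded Γ C
  ∨I₁  : ∀ {A B C} → Ded Γ A → Ded ((A ∨ B) ∷ Γ) C → Ded Γ C
  ∨I₂  : ∀ {A B C} → Ded Γ B → Ded ((A ∨ B) ∷ Γ) C → Ded Γ C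
  ∨E   : ∀ {A B C} → Ded Γ (A ∨ B) → Ded (A ∷ Γ) C → Ded (B ∷ Γ) C → Ded Γ C
  ⊃I   : ∀ {A B C} → Ded Γ B → Ded ((A ⊃ B) ∷ Γ) C → Ded Γ C
  TR   : ∀ {A B C} → Ded (A ∷ Γ) C → Ded ((A ⊃ B) ∷ Γ) C → Ded Γ C
  ⊃E   : ∀ {A B C} → Ded Γ (A ⊃ B) → Ded Γ A → Ded (B ∷ Γ) C → Ded Γ C
  ¬I   : ∀ {A C} → Ded (A ∷ Γ) C → Ded ((¬' A) ∷ Γ) C → Ded Γ C
  ¬E   : ∀ {A C} → Ded Γ (¬' A) → Ded Γ A → Ded Γ C

Occurs : ∀ {Γ A C} → A ∈ Γ → Ded Γ C → Set
Occurs x (ass y)        = index x ≡ index y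
Occurs x (∧I d₁ d₂ d₃)  = Occurs x d₁ ⊎ Occurs x d₂ ⊎ Occurs (there x) d₃
Occurs x (∧E d₁ d₂)     = Occurs x d₁ ⊎ Occurs (there (there x)) d₂
Occurs x (∨I₁ d₁ d₂)    = Occurs x d₁ ⊎ Occurs (there x) d₂
Occurs x (∨I₂ d₁ d₂)    = Occurs x d₁ ⊎ Occurs (there x) d₂
Occurs x (∨E d₁ d₂ d₃)  = Occurs x d₁ ⊎ Occurs (there x) d₂ ⊎ Occurs (there x) d₃
Occurs x (⊃I d₁ d₂)     = Occurs x d₁ ⊎ Occurs (there x) d₂
Occurs x (TR d₁ d₂)     = Occurs (there x) d₁ ⊎ Occurs (there x) d₂
Occurs x (⊃E d₁ d₂ d₃)  = Occurs x d₁ ⊎ Occurs x d₂ ⊎ Occurs (there x) d₃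
Occurs x (¬I d₁ d₂)     = Occurs (there x) d₁ ⊎ Occurs (there x) d₂
Occurs x (¬E d₁ d₂)     = Occurs x d₁ ⊎ Occurs x d₂

-- The convention: no vacuous discharge above arbitrary premises
-- (every discharge discharges at least one occurrence, except that ∧E
-- may discharge only one of A, B).  A deduction of C satisfies it.

WF : ∀ {Γ C} → Ded Γ C → Set
WF (ass x)        = ⊤
WF (∧I d₁ d₂ d₃)  = WF d₁ × WF d₂ × WF d₃ × Occurs (here refl) d₃
WF (∧E d₁ d₂)     = WF d₁ × WF d₂ × (Occurs (here refl) d₂ ⊎ Occurs (there (here refl)) d₂)
WF (∨I₁ d₁ d₂)    = WF d₁ × WF d₂ × Occurs (here refl) d₂
WF (∨I₂ d₁ d₂)    = WF d₁ × WF d₂ × Occurs (here refl) d₂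
WF (∨E d₁ d₂ d₃)  = WF d₁ × WF d₂ × WF d₃ × Occurs (here refl) d₂ × Occurs (here refl) d₃
WF (⊃I d₁ d₂)     = WF d₁ × WF d₂ × Occurs (here refl) d₂
WF (TR d₁ d₂)     = WF d₁ × WF d₂ × Occurs (here refl) d₁ × Occurs (here refl) d₂
WF (⊃E d₁ d₂ d₃)  = WF d₁ × WF d₂ × WF d₃ × Occurs (here refl) d₃
WF (¬I d₁ d₂)     = WF d₁ × WF d₂ × Occurs (here refl) d₁ × Occurs (here refl) d₂
WF (¬E d₁ d₂)     = WF d₁ × WF d₂

-- Segments.
-- Chain d n b : there is a sequence C₁,…,Cₙ of occurrences of the same
-- formula, ending with the conclusion of d (Cₙ), such that each Cᵢ
-- (i < n) is an arbitrary premise of the rule application whose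
-- conclusion is Cᵢ₊₁; b records whether C₁ is the conclusion of ¬E.

isNegE : ∀ {Γ C} → Ded Γ C → Bool
isNegE (¬E _ _) = true
isNegE _        = false

data Chain : ∀ {Γ C} → Ded Γ C → ℕ → Bool → Set where
  start : ∀ {Γ C} (d : Ded Γ C) → Chain d 1 (isNegE d)
  ∧I₃   : ∀ {Γ A B C n b} {d₁ : Ded Γ A} {d₂ : Ded Γ B} {d₃ : Ded ((A ∧ B) ∷ Γ) C}
          → Chain d₃ n b → Chain (∧I d₁ d₂ d₃) (Data.Nat.suc n) b
  ∧E₂   : ∀ {Γ A B C n b} {d₁ : Ded Γ (A ∧ B)} {d₂ : Ded (A ∷ B ∷ Γ) C}
          → Chain d₂ n b → Chain (∧E d₁ d₂) (Data.Nat.suc n) b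
  ∨I₁₂  : ∀ {Γ A B C n b} {d₁ : Ded Γ A} {d₂ : Ded ((A ∨ B) ∷ Γ) C}
          → Chain d₂ n b → Chain (∨I₁ d₁ d₂) (Data.Nat.suc n) b
  ∨I₂₂  : ∀ {Γ A B C n b} {d₁ : Ded Γ B} {d₂ : Ded ((A ∨ B) ∷ Γ) C}
          → Chain d₂ n b → Chain (∨I₂ d₁ d₂) (Data.Nat.suc n) b
  ∨E₂   : ∀ {Γ A B C n b} {d₁ : Ded Γ (A ∨ B)} {d₂ : Ded (A ∷ Γ) C} {d₃ : Ded (B ∷ Γ) C}
          → Chain d₂ n b → Chain (∨E d₁ d₂ d₃) (Data.Nat.suc n) b
  ∨E₃   : ∀ {Γ A B C n b} {d₁ : Ded Γ (A ∨ B)} {d₂ : Ded (A ∷ Γ) C} {d₃ : Ded (B ∷ Γ) C}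
          → Chain d₃ n b → Chain (∨E d₁ d₂ d₃) (Data.Nat.suc n) b
  ⊃I₂   : ∀ {Γ A B C n b} {d₁ : Ded Γ B} {d₂ : Ded ((A ⊃ B) ∷ Γ) C}
          → Chain d₂ n b → Chain (⊃I d₁ d₂) (Data.Nat.suc n) b
  TR₁   : ∀ {Γ A B C n b} {d₁ : Ded (A ∷ Γ) C} {d₂ : Ded ((A ⊃ B) ∷ Γ) C}
          → Chain d₁ n b → Chain (TR d₁ d₂) (Data.Nat.suc n) b
  TR₂   : ∀ {Γ A B C n b} {d₁ : Ded (A ∷ Γ) C} {d₂ : Ded ((A ⊃ B) ∷ Γ) C}
          → Chain d₂ n b → Chain (TR d₁ d₂) (Data.Nat.suc n) b
  ⊃E₃   : ∀ {Γ A B C n b} {d₁ : Ded Γ (A ⊃ B)} {d₂ : Ded Γ A} {d₃ : Ded (B ∷ Γ) C}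
          → Chain d₃ n b → Chain (⊃E d₁ d₂ d₃) (Data.Nat.suc n) b
  ¬I₁   : ∀ {Γ A C n b} {d₁ : Ded (A ∷ Γ) C} {d₂ : Ded ((¬' A) ∷ Γ) C}
          → Chain d₁ n b → Chain (¬I d₁ d₂) (Data.Nat.suc n) b
  ¬I₂   : ∀ {Γ A C n b} {d₁ : Ded (A ∷ Γ) C} {d₂ : Ded ((¬' A) ∷ Γ) C}
          → Chain d₂ n b → Chain (¬I d₁ d₂) (Data.Nat.suc n) b

-- A segment ending with the conclusion of d (n > 1, or n ≥ 1 and C₁
-- is the conclusion of ¬E).  It is only used at major premises, which
-- are never arbitrary premises, so the requirement on Cₙ holds there.
Segment : ∀ {Γ C} → Ded Γ C → Set
Segment d = Σ ℕ λ n → Σ Bool λ b → Chain d n b × (1 < n ⊎ b ≡ true)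

-- Normal form.
-- Tags Γ marks, for each assumption class in context, whether it was
-- discharged as the major assumption of an introduction rule
-- (A ∧ B in ∧I, A ∨ B in ∨I, A ⊃ B in ⊃I and TR, ¬A in ¬I).

Tags : List Form → Set
Tags Γ = ∀ {A} → A ∈ Γ → Bool

_▸_ : ∀ {Γ B} → Bool → Tags Γ → Tags (B ∷ Γ)
(b ▸ t) (here _)  = b
(b ▸ t) (there x) = t x

-- The major premise (conclusion of d) is not a maximal formula: it is
-- not an assumption occurrence discharged as major assumption of an
-- introduction rule (its connective then automatically matches).
NotMaxFormula : ∀ {Γ C} → Tags Γ → Ded Γ C → Set
NotMaxFormula t (ass x) = t x ≡ false
NotMaxFormula t _       = ⊤

OkMajor : ∀ {Γ C} → Tags Γ → Ded Γ C → Set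
OkMajor t d = NotMaxFormula t d × ¬ Segment d

NormalT : ∀ {Γ C} → Tags Γ → Ded Γ C → Set
NormalT t (ass x)       = ⊤
NormalT t (∧I d₁ d₂ d₃) = NormalT t d₁ × NormalT t d₂ × NormalT (true ▸ t) d₃
NormalT t (∧E d₁ d₂)    = OkMajor t d₁ × NormalT t d₁ × NormalT (false ▸ (false ▸ t)) d₂
NormalT t (∨I₁ d₁ d₂)   = NormalT t d₁ × NormalT (true ▸ t) d₂
NormalT t (∨I₂ d₁ d₂)   = NormalT t d₁ × NormalT (true ▸ t) d₂
NormalT t (∨E d₁ d₂ d₃) = OkMajor t d₁ × NormalT t d₁ × NormalT (false ▸ t) d₂ × NormalT (false ▸ t) d₃
NormalT t (⊃I d₁ d₂)    = NormalT t d₁ × NormalT (true ▸ t) d₂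
NormalT t (TR d₁ d₂)    = NormalT (false ▸ t) d₁ × NormalT (true ▸ t) d₂
NormalT t (⊃E d₁ d₂ d₃) = OkMajor t d₁ × NormalT t d₁ × NormalT t d₂ × NormalT (false ▸ t) d₃
NormalT t (¬I d₁ d₂)    = NormalT (false ▸ t) d₁ × NormalT (true ▸ t) d₂
NormalT t (¬E d₁ d₂)    = OkMajor t d₁ × NormalT t d₁ × NormalT t d₂

-- Undischarged assumptions of the whole deduction are not discharged
-- by any rule.
Normal : ∀ {Γ C} → Ded Γ C → Set
Normal d = NormalT (λ _ → false) d

{-# OPTIONS --safe #-}

-- Normality says exactly that every major premise is an assumption that no
-- introduction rule discharges.  Normal deductions are complete for the
-- two-valued semantics, by a Kalmár-style argument: under a valuation v whose
-- true atoms are available as eliminable assumptions, and for whose false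
-- atoms p the goal is already derivable from p, every v-false assumption can
-- be eliminated into the goal, and every v-true formula can be introduced as
-- an assumption towards the goal.  An atom p is decided without any rule:
-- "the goal follows from p" is what the false case needs to know, and the
-- true case proves it.  Normalization is soundness, applied to the
-- assumptions that occur, followed by this completeness; vacuous discharges
-- are removed by strengthening.

module Submission where

open import Defs
open import Data.Bool as Bool using (Bool; true; false)
open import Data.Bool.Properties using (¬-not)
open import Data.Empty using (⊥-elim)
open import Data.Fin.Properties using (suc-injective; _≟_)
open import Data.List using (List; []; _∷_; _++_; concatMap)
open import Data.Nat as ℕ using (ℕ; s≤s; z≤n)
open import Data.List.Membership.DecPropositional ℕ._≟_ using (_∈?_)
open import Data.List.Membership.Propositional using (_∈_; find)
open import Data.List.Membership.Propositional.Properties using (∈-++⁺ˡ; ∈-++⁺ʳ; ∈-concatMap⁺)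
open import Data.List.Relation.Unary.All using (all?; lookup)
open import Data.List.Relation.Unary.All.Properties using (¬All⇒Any¬)
open import Data.List.Relation.Unary.Any as Any using (here; there; index)
open import Data.Product using (Σ; _×_; _,_)
open import Data.Sum using (_⊎_; inj₁; inj₂)
open import Data.Unit using (⊤; tt)
open import Function using (_∘_)
open import Relation.Binary.PropositionalEquality using (_≡_; refl; sym; trans; cong; subst)
open import Relation.Nullary using (Dec; yes; no; does; contradiction)
open import Relation.Nullary.Decidable using (_⊎-dec_)

private variable
  Γ Δ : List Form
  A B C : Form

-- Occurrences and renaming

-- `Occurs` compares bare positions, across formulas not known to be equal. Equal positions are
-- turned back into equal membership proofs here, so that one can replace the other.
index-injective : (x : A ∈ Γ) (y : B ∈ Γ) → index x ≡ index y →
  Σ (A ≡ B) λ e → subst (_∈ Γ) e x ≡ y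
index-injective (here refl) (here refl) e = refl , refl
index-injective (there x) (there y) e with index-injective x y (suc-injective e)
... | refl , refl = refl , refl

occurs? : (x : A ∈ Γ) (d : Ded Γ C) → Dec (Occurs x d)
occurs? x (ass y)       = index x ≟ index y
occurs? x (∧I d₁ d₂ d₃) = occurs? x d₁ ⊎-dec (occurs? x d₂ ⊎-dec occurs? (there x) d₃)
occurs? x (∧E d₁ d₂)    = occurs? x d₁ ⊎-dec occurs? (there (there x)) d₂
occurs? x (∨I₁ d₁ d₂)   = occurs? x d₁ ⊎-dec occurs? (there x) d₂
occurs? x (∨I₂ d₁ d₂)   = occurs? x d₁ ⊎-dec occurs? (there x) d₂
occurs? x (∨E d₁ d₂ d₃) = occurs? x d₁ ⊎-dec (occurs? (there x) d₂ ⊎-dec occurs? (there x) d₃)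
occurs? x (⊃I d₁ d₂)    = occurs? x d₁ ⊎-dec occurs? (there x) d₂
occurs? x (TR d₁ d₂)    = occurs? (there x) d₁ ⊎-dec occurs? (there x) d₂
occurs? x (⊃E d₁ d₂ d₃) = occurs? x d₁ ⊎-dec (occurs? x d₂ ⊎-dec occurs? (there x) d₃)
occurs? x (¬I d₁ d₂)    = occurs? (there x) d₁ ⊎-dec occurs? (there x) d₂
occurs? x (¬E d₁ d₂)    = occurs? x d₁ ⊎-dec occurs? x d₂

VarPred : List Form → Set₁
VarPred Γ = ∀ {A} → A ∈ Γ → Set

-- Defined only on the variables that occur in d, so that weakening and
-- strengthening are both instances.
Renaming : Ded Γ C → List Form → Set
Renaming {Γ} d Δ = ∀ {A} (x : A ∈ Γ) → Occurs x d → A ∈ Δ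

lift : (d : Ded (B ∷ Γ) C) → (∀ {A} (x : A ∈ Γ) → Occurs (there x) d → A ∈ Δ) →
  Renaming d (B ∷ Δ)
lift d ρ (here p)  _ = here p
lift d ρ (there x) o = there (ρ x o)

lift₂ : (d : Ded (A ∷ B ∷ Γ) C) →
  (∀ {D} (x : D ∈ Γ) → Occurs (there (there x)) d → D ∈ Δ) → Renaming d (A ∷ B ∷ Δ)
lift₂ d ρ (here p)          _ = here p
lift₂ d ρ (there (here p))  _ = there (here p)
lift₂ d ρ (there (there x)) o = there (there (ρ x o))

rename : (d : Ded Γ C) → Renaming d Δ → Ded Δ C
rename (ass y) ρ = ass (ρ y refl)
rename (∧I d₁ d₂ d₃) ρ =
  ∧I (rename d₁ λ x → ρ x ∘ inj₁) (rename d₂ λ x → ρ x ∘ inj₂ ∘ inj₁)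
     (rename d₃ (lift d₃ λ x → ρ x ∘ inj₂ ∘ inj₂))
rename (∧E d₁ d₂) ρ =
  ∧E (rename d₁ λ x → ρ x ∘ inj₁) (rename d₂ (lift₂ d₂ λ x → ρ x ∘ inj₂))
rename (∨I₁ d₁ d₂) ρ = ∨I₁ (rename d₁ λ x → ρ x ∘ inj₁) (rename d₂ (lift d₂ λ x → ρ x ∘ inj₂))
rename (∨I₂ d₁ d₂) ρ = ∨I₂ (rename d₁ λ x → ρ x ∘ inj₁) (rename d₂ (lift d₂ λ x → ρ x ∘ inj₂))
rename (∨E d₁ d₂ d₃) ρ =
  ∨E (rename d₁ λ x → ρ x ∘ inj₁) (rename d₂ (lift d₂ λ x → ρ x ∘ inj₂ ∘ inj₁))
     (rename d₃ (lift d₃ λ x → ρ x ∘ inj₂ ∘ inj₂))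
rename (⊃I d₁ d₂) ρ = ⊃I (rename d₁ λ x → ρ x ∘ inj₁) (rename d₂ (lift d₂ λ x → ρ x ∘ inj₂))
rename (TR d₁ d₂) ρ =
  TR (rename d₁ (lift d₁ λ x → ρ x ∘ inj₁)) (rename d₂ (lift d₂ λ x → ρ x ∘ inj₂))
rename (⊃E d₁ d₂ d₃) ρ =
  ⊃E (rename d₁ λ x → ρ x ∘ inj₁) (rename d₂ λ x → ρ x ∘ inj₂ ∘ inj₁)
     (rename d₃ (lift d₃ λ x → ρ x ∘ inj₂ ∘ inj₂))
rename (¬I d₁ d₂) ρ =
  ¬I (rename d₁ (lift d₁ λ x → ρ x ∘ inj₁)) (rename d₂ (lift d₂ λ x → ρ x ∘ inj₂))
rename (¬E d₁ d₂) ρ = ¬E (rename d₁ λ x → ρ x ∘ inj₁) (rename d₂ λ x → ρ x ∘ inj₂)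

-- Applied to bound variables: `lift` sends `here` to `here`, so a discharge that is not vacuous
-- stays so after renaming.
rename-occurs : (d : Ded Γ C) (ρ : Renaming d Δ)
  (x : A ∈ Γ) (o : Occurs x d) → Occurs (ρ x o) (rename d ρ)
rename-occurs (ass y) ρ x o with index-injective x y o
rename-occurs (ass y) ρ x refl | refl , refl = refl
rename-occurs (∧I d₁ d₂ d₃) ρ x (inj₁ o)        = inj₁ (rename-occurs d₁ _ x o)
rename-occurs (∧I d₁ d₂ d₃) ρ x (inj₂ (inj₁ o)) = inj₂ (inj₁ (rename-occurs d₂ _ x o))
rename-occurs (∧I d₁ d₂ d₃) ρ x (inj₂ (inj₂ o)) = inj₂ (inj₂ (rename-occurs d₃ _ (there x) o))
rename-occurs (∧E d₁ d₂) ρ x (inj₁ o)  = inj₁ (rename-occurs d₁ _ x o)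
rename-occurs (∧E d₁ d₂) ρ x (inj₂ o)  = inj₂ (rename-occurs d₂ _ (there (there x)) o)
rename-occurs (∨I₁ d₁ d₂) ρ x (inj₁ o) = inj₁ (rename-occurs d₁ _ x o)
rename-occurs (∨I₁ d₁ d₂) ρ x (inj₂ o) = inj₂ (rename-occurs d₂ _ (there x) o)
rename-occurs (∨I₂ d₁ d₂) ρ x (inj₁ o) = inj₁ (rename-occurs d₁ _ x o)
rename-occurs (∨I₂ d₁ d₂) ρ x (inj₂ o) = inj₂ (rename-occurs d₂ _ (there x) o)
rename-occurs (∨E d₁ d₂ d₃) ρ x (inj₁ o)        = inj₁ (rename-occurs d₁ _ x o)
rename-occurs (∨E d₁ d₂ d₃) ρ x (inj₂ (inj₁ o)) = inj₂ (inj₁ (rename-occurs d₂ _ (there x) o))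
rename-occurs (∨E d₁ d₂ d₃) ρ x (inj₂ (inj₂ o)) = inj₂ (inj₂ (rename-occurs d₃ _ (there x) o))
rename-occurs (⊃I d₁ d₂) ρ x (inj₁ o) = inj₁ (rename-occurs d₁ _ x o)
rename-occurs (⊃I d₁ d₂) ρ x (inj₂ o) = inj₂ (rename-occurs d₂ _ (there x) o)
rename-occurs (TR d₁ d₂) ρ x (inj₁ o) = inj₁ (rename-occurs d₁ _ (there x) o)
rename-occurs (TR d₁ d₂) ρ x (inj₂ o) = inj₂ (rename-occurs d₂ _ (there x) o)
rename-occurs (⊃E d₁ d₂ d₃) ρ x (inj₁ o)        = inj₁ (rename-occurs d₁ _ x o)
rename-occurs (⊃E d₁ d₂ d₃) ρ x (inj₂ (inj₁ o)) = inj₂ (inj₁ (rename-occurs d₂ _ x o))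
rename-occurs (⊃E d₁ d₂ d₃) ρ x (inj₂ (inj₂ o)) = inj₂ (inj₂ (rename-occurs d₃ _ (there x) o))
rename-occurs (¬I d₁ d₂) ρ x (inj₁ o) = inj₁ (rename-occurs d₁ _ (there x) o)
rename-occurs (¬I d₁ d₂) ρ x (inj₂ o) = inj₂ (rename-occurs d₂ _ (there x) o)
rename-occurs (¬E d₁ d₂) ρ x (inj₁ o) = inj₁ (rename-occurs d₁ _ x o)
rename-occurs (¬E d₁ d₂) ρ x (inj₂ o) = inj₂ (rename-occurs d₂ _ x o)

rename-WF : (d : Ded Γ C) (ρ : Renaming d Δ) → WF d → WF (rename d ρ)
rename-WF (ass y) ρ _ = tt
rename-WF (∧I d₁ d₂ d₃) ρ (w₁ , w₂ , w₃ , o) =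
  rename-WF d₁ _ w₁ , rename-WF d₂ _ w₂ , rename-WF d₃ _ w₃ , rename-occurs d₃ _ (here refl) o
rename-WF (∧E d₁ d₂) ρ (w₁ , w₂ , inj₁ o) =
  rename-WF d₁ _ w₁ , rename-WF d₂ _ w₂ , inj₁ (rename-occurs d₂ _ (here refl) o)
rename-WF (∧E d₁ d₂) ρ (w₁ , w₂ , inj₂ o) =
  rename-WF d₁ _ w₁ , rename-WF d₂ _ w₂ , inj₂ (rename-occurs d₂ _ (there (here refl)) o)
rename-WF (∨I₁ d₁ d₂) ρ (w₁ , w₂ , o) =
  rename-WF d₁ _ w₁ , rename-WF d₂ _ w₂ , rename-occurs d₂ _ (here refl) o
rename-WF (∨I₂ d₁ d₂) ρ (w₁ , w₂ , o) =
  rename-WF d₁ _ w₁ , rename-WF d₂ _ w₂ , rename-occurs d₂ _ (here refl) o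
rename-WF (∨E d₁ d₂ d₃) ρ (w₁ , w₂ , w₃ , o₂ , o₃) =
  rename-WF d₁ _ w₁ , rename-WF d₂ _ w₂ , rename-WF d₃ _ w₃ ,
  rename-occurs d₂ _ (here refl) o₂ , rename-occurs d₃ _ (here refl) o₃
rename-WF (⊃I d₁ d₂) ρ (w₁ , w₂ , o) =
  rename-WF d₁ _ w₁ , rename-WF d₂ _ w₂ , rename-occurs d₂ _ (here refl) o
rename-WF (TR d₁ d₂) ρ (w₁ , w₂ , o₁ , o₂) =
  rename-WF d₁ _ w₁ , rename-WF d₂ _ w₂ ,
  rename-occurs d₁ _ (here refl) o₁ , rename-occurs d₂ _ (here refl) o₂
rename-WF (⊃E d₁ d₂ d₃) ρ (w₁ , w₂ , w₃ , o) =
  rename-WF d₁ _ w₁ , rename-WF d₂ _ w₂ , rename-WF d₃ _ w₃ , rename-occurs d₃ _ (here refl) o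
rename-WF (¬I d₁ d₂) ρ (w₁ , w₂ , o₁ , o₂) =
  rename-WF d₁ _ w₁ , rename-WF d₂ _ w₂ ,
  rename-occurs d₁ _ (here refl) o₁ , rename-occurs d₂ _ (here refl) o₂
rename-WF (¬E d₁ d₂) ρ (w₁ , w₂) = rename-WF d₁ _ w₁ , rename-WF d₂ _ w₂

-- Tags and normality under renaming

PreservesTags : Tags Γ → Tags Δ → (d : Ded Γ C) → Renaming d Δ → Set
PreservesTags {Γ} t t′ d ρ = ∀ {A} (x : A ∈ Γ) (o : Occurs x d) → t′ (ρ x o) ≡ t x

-- The only chain ending in a leaf has length 1 and does not begin with `¬E`, so it is no segment.
ass-okMajor : (t : Tags Γ) {x : A ∈ Γ} → t x ≡ false → OkMajor t (ass x)
ass-okMajor t e = e , λ where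
  (_ , _ , start _ , inj₁ (s≤s ()))
  (_ , _ , start _ , inj₂ ())

-- Every rule except `¬E` has an arbitrary premise, which together with the conclusion forms a chain
-- of length 2; the conclusion of `¬E` is a segment by itself. Only a leaf remains.
okMajor-ass : {t : Tags Γ} (d : Ded Γ A) → OkMajor t d →
  Σ (A ∈ Γ) λ x → d ≡ ass x × t x ≡ false
okMajor-ass (ass x) (e , _) = x , refl , e
okMajor-ass (∧I _ _ d) (_ , s) = ⊥-elim (s (2 , _ , ∧I₃ (start d) , inj₁ (s≤s (s≤s z≤n))))
okMajor-ass (∧E _ d)   (_ , s) = ⊥-elim (s (2 , _ , ∧E₂ (start d) , inj₁ (s≤s (s≤s z≤n))))
okMajor-ass (∨I₁ _ d)  (_ , s) = ⊥-elim (s (2 , _ , ∨I₁₂ (start d) , inj₁ (s≤s (s≤s z≤n))))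
okMajor-ass (∨I₂ _ d)  (_ , s) = ⊥-elim (s (2 , _ , ∨I₂₂ (start d) , inj₁ (s≤s (s≤s z≤n))))
okMajor-ass (∨E _ _ d) (_ , s) = ⊥-elim (s (2 , _ , ∨E₃ (start d) , inj₁ (s≤s (s≤s z≤n))))
okMajor-ass (⊃I _ d)   (_ , s) = ⊥-elim (s (2 , _ , ⊃I₂ (start d) , inj₁ (s≤s (s≤s z≤n))))
okMajor-ass (TR _ d)   (_ , s) = ⊥-elim (s (2 , _ , TR₂ (start d) , inj₁ (s≤s (s≤s z≤n))))
okMajor-ass (⊃E _ _ d) (_ , s) = ⊥-elim (s (2 , _ , ⊃E₃ (start d) , inj₁ (s≤s (s≤s z≤n))))
okMajor-ass (¬I _ d)   (_ , s) = ⊥-elim (s (2 , _ , ¬I₂ (start d) , inj₁ (s≤s (s≤s z≤n))))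
okMajor-ass (¬E d d′)  (_ , s) = ⊥-elim (s (1 , true , start (¬E d d′) , inj₂ refl))

-- No chain has to be transported: the major premise is a leaf, and only its tag is to be followed.
rename-okMajor : {t : Tags Γ} (t′ : Tags Δ) (d : Ded Γ A)
  (ρ : Renaming d Δ) → PreservesTags t t′ d ρ →
  OkMajor t d → OkMajor t′ (rename d ρ)
rename-okMajor t′ d ρ e ok with okMajor-ass d ok
... | x , refl , f = ass-okMajor t′ (trans (e x refl) f)

rename-normal : {t : Tags Γ} {t′ : Tags Δ} (d : Ded Γ C)
  (ρ : Renaming d Δ) → PreservesTags t t′ d ρ →
  NormalT t d → NormalT t′ (rename d ρ)
rename-normal (ass y) ρ e _ = tt
rename-normal (∧I d₁ d₂ d₃) ρ e (n₁ , n₂ , n₃) =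
  rename-normal d₁ _ (λ x → e x ∘ inj₁) n₁ ,
  rename-normal d₂ _ (λ x → e x ∘ inj₂ ∘ inj₁) n₂ ,
  rename-normal d₃ _ (λ { (here _) _ → refl ; (there x) o → e x (inj₂ (inj₂ o)) }) n₃
rename-normal {t′ = t′} (∧E d₁ d₂) ρ e (m , n₁ , n₂) =
  rename-okMajor t′ d₁ _ (λ x → e x ∘ inj₁) m ,
  rename-normal d₁ _ (λ x → e x ∘ inj₁) n₁ ,
  rename-normal d₂ _
    (λ { (here _) _ → refl ; (there (here _)) _ → refl ; (there (there x)) o → e x (inj₂ o) }) n₂
rename-normal (∨I₁ d₁ d₂) ρ e (n₁ , n₂) =
  rename-normal d₁ _ (λ x → e x ∘ inj₁) n₁ ,
  rename-normal d₂ _ (λ { (here _) _ → refl ; (there x) o → e x (inj₂ o) }) n₂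
rename-normal (∨I₂ d₁ d₂) ρ e (n₁ , n₂) =
  rename-normal d₁ _ (λ x → e x ∘ inj₁) n₁ ,
  rename-normal d₂ _ (λ { (here _) _ → refl ; (there x) o → e x (inj₂ o) }) n₂
rename-normal {t′ = t′} (∨E d₁ d₂ d₃) ρ e (m , n₁ , n₂ , n₃) =
  rename-okMajor t′ d₁ _ (λ x → e x ∘ inj₁) m ,
  rename-normal d₁ _ (λ x → e x ∘ inj₁) n₁ ,
  rename-normal d₂ _ (λ { (here _) _ → refl ; (there x) o → e x (inj₂ (inj₁ o)) }) n₂ ,
  rename-normal d₃ _ (λ { (here _) _ → refl ; (there x) o → e x (inj₂ (inj₂ o)) }) n₃
rename-normal (⊃I d₁ d₂) ρ e (n₁ , n₂) =
  rename-normal d₁ _ (λ x → e x ∘ inj₁) n₁ ,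
  rename-normal d₂ _ (λ { (here _) _ → refl ; (there x) o → e x (inj₂ o) }) n₂
rename-normal (TR d₁ d₂) ρ e (n₁ , n₂) =
  rename-normal d₁ _ (λ { (here _) _ → refl ; (there x) o → e x (inj₁ o) }) n₁ ,
  rename-normal d₂ _ (λ { (here _) _ → refl ; (there x) o → e x (inj₂ o) }) n₂
rename-normal {t′ = t′} (⊃E d₁ d₂ d₃) ρ e (m , n₁ , n₂ , n₃) =
  rename-okMajor t′ d₁ _ (λ x → e x ∘ inj₁) m ,
  rename-normal d₁ _ (λ x → e x ∘ inj₁) n₁ ,
  rename-normal d₂ _ (λ x → e x ∘ inj₂ ∘ inj₁) n₂ ,
  rename-normal d₃ _ (λ { (here _) _ → refl ; (there x) o → e x (inj₂ (inj₂ o)) }) n₃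
rename-normal (¬I d₁ d₂) ρ e (n₁ , n₂) =
  rename-normal d₁ _ (λ { (here _) _ → refl ; (there x) o → e x (inj₁ o) }) n₁ ,
  rename-normal d₂ _ (λ { (here _) _ → refl ; (there x) o → e x (inj₂ o) }) n₂
rename-normal {t′ = t′} (¬E d₁ d₂) ρ e (m , n₁ , n₂) =
  rename-okMajor t′ d₁ _ (λ x → e x ∘ inj₁) m ,
  rename-normal d₁ _ (λ x → e x ∘ inj₁) n₁ ,
  rename-normal d₂ _ (λ x → e x ∘ inj₂) n₂

-- Assumptions occurring in a renamed deduction

OccursOnly : VarPred Γ → Ded Γ C → Set
OccursOnly {Γ} Q d = ∀ {A} (x : A ∈ Γ) → Occurs x d → Q x

extend : VarPred Γ → VarPred (B ∷ Γ)
extend Q (here _)  = ⊤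
extend Q (there x) = Q x

-- A converse to `rename-occurs`: whatever occurs after renaming is an image. Phrasing it with a
-- predicate on the target spares the preimages; under a binder `extend` makes the predicate trivial
-- at the discharged class.
rename-occursOnly : (Q : VarPred Δ) (d : Ded Γ C) (ρ : Renaming d Δ) →
  (∀ {A} (x : A ∈ Γ) (o : Occurs x d) → Q (ρ x o)) → OccursOnly Q (rename d ρ)
rename-occursOnly Q (ass y) ρ q x o with index-injective x (ρ y refl) o
... | refl , refl = q y refl
rename-occursOnly Q (∧I d₁ d₂ d₃) ρ q x (inj₁ o) = rename-occursOnly Q d₁ _ (λ x → q x ∘ inj₁) x o
rename-occursOnly Q (∧I d₁ d₂ d₃) ρ q x (inj₂ (inj₁ o)) =
  rename-occursOnly Q d₂ _ (λ x → q x ∘ inj₂ ∘ inj₁) x o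
rename-occursOnly Q (∧I d₁ d₂ d₃) ρ q x (inj₂ (inj₂ o)) = rename-occursOnly (extend Q) d₃ _
  (λ { (here _) _ → tt ; (there x) o → q x (inj₂ (inj₂ o)) }) (there x) o
rename-occursOnly Q (∧E d₁ d₂) ρ q x (inj₁ o) = rename-occursOnly Q d₁ _ (λ x → q x ∘ inj₁) x o
rename-occursOnly Q (∧E d₁ d₂) ρ q x (inj₂ o) = rename-occursOnly (extend (extend Q)) d₂ _
  (λ { (here _) _ → tt ; (there (here _)) _ → tt ; (there (there x)) o → q x (inj₂ o) }) (there (there x)) o
rename-occursOnly Q (∨I₁ d₁ d₂) ρ q x (inj₁ o) = rename-occursOnly Q d₁ _ (λ x → q x ∘ inj₁) x o
rename-occursOnly Q (∨I₁ d₁ d₂) ρ q x (inj₂ o) = rename-occursOnly (extend Q) d₂ _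
  (λ { (here _) _ → tt ; (there x) o → q x (inj₂ o) }) (there x) o
rename-occursOnly Q (∨I₂ d₁ d₂) ρ q x (inj₁ o) = rename-occursOnly Q d₁ _ (λ x → q x ∘ inj₁) x o
rename-occursOnly Q (∨I₂ d₁ d₂) ρ q x (inj₂ o) = rename-occursOnly (extend Q) d₂ _
  (λ { (here _) _ → tt ; (there x) o → q x (inj₂ o) }) (there x) o
rename-occursOnly Q (∨E d₁ d₂ d₃) ρ q x (inj₁ o) = rename-occursOnly Q d₁ _ (λ x → q x ∘ inj₁) x o
rename-occursOnly Q (∨E d₁ d₂ d₃) ρ q x (inj₂ (inj₁ o)) = rename-occursOnly (extend Q) d₂ _
  (λ { (here _) _ → tt ; (there x) o → q x (inj₂ (inj₁ o)) }) (there x) o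
rename-occursOnly Q (∨E d₁ d₂ d₃) ρ q x (inj₂ (inj₂ o)) = rename-occursOnly (extend Q) d₃ _
  (λ { (here _) _ → tt ; (there x) o → q x (inj₂ (inj₂ o)) }) (there x) o
rename-occursOnly Q (⊃I d₁ d₂) ρ q x (inj₁ o) = rename-occursOnly Q d₁ _ (λ x → q x ∘ inj₁) x o
rename-occursOnly Q (⊃I d₁ d₂) ρ q x (inj₂ o) = rename-occursOnly (extend Q) d₂ _
  (λ { (here _) _ → tt ; (there x) o → q x (inj₂ o) }) (there x) o
rename-occursOnly Q (TR d₁ d₂) ρ q x (inj₁ o) = rename-occursOnly (extend Q) d₁ _
  (λ { (here _) _ → tt ; (there x) o → q x (inj₁ o) }) (there x) o
rename-occursOnly Q (TR d₁ d₂) ρ q x (inj₂ o) = rename-occursOnly (extend Q) d₂ _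
  (λ { (here _) _ → tt ; (there x) o → q x (inj₂ o) }) (there x) o
rename-occursOnly Q (⊃E d₁ d₂ d₃) ρ q x (inj₁ o) = rename-occursOnly Q d₁ _ (λ x → q x ∘ inj₁) x o
rename-occursOnly Q (⊃E d₁ d₂ d₃) ρ q x (inj₂ (inj₁ o)) =
  rename-occursOnly Q d₂ _ (λ x → q x ∘ inj₂ ∘ inj₁) x o
rename-occursOnly Q (⊃E d₁ d₂ d₃) ρ q x (inj₂ (inj₂ o)) = rename-occursOnly (extend Q) d₃ _
  (λ { (here _) _ → tt ; (there x) o → q x (inj₂ (inj₂ o)) }) (there x) o
rename-occursOnly Q (¬I d₁ d₂) ρ q x (inj₁ o) = rename-occursOnly (extend Q) d₁ _
  (λ { (here _) _ → tt ; (there x) o → q x (inj₁ o) }) (there x) o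
rename-occursOnly Q (¬I d₁ d₂) ρ q x (inj₂ o) = rename-occursOnly (extend Q) d₂ _
  (λ { (here _) _ → tt ; (there x) o → q x (inj₂ o) }) (there x) o
rename-occursOnly Q (¬E d₁ d₂) ρ q x (inj₁ o) = rename-occursOnly Q d₁ _ (λ x → q x ∘ inj₁) x o
rename-occursOnly Q (¬E d₁ d₂) ρ q x (inj₂ o) = rename-occursOnly Q d₂ _ (λ x → q x ∘ inj₂) x o

-- Two-valued semantics

eval : (ℕ → Bool) → Form → Bool
eval v (atom p) = v p
eval v (¬' A)   = Bool.not (eval v A)
eval v (A ⊃ B)  = Bool.not (eval v A) Bool.∨ eval v B
eval v (A ∧ B)  = eval v A Bool.∧ eval v B
eval v (A ∨ B)  = eval v A Bool.∨ eval v B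

atoms : Form → List ℕ
atoms (atom p) = p ∷ []
atoms (¬' A)   = atoms A
atoms (A ⊃ B)  = atoms A ++ atoms B
atoms (A ∧ B)  = atoms A ++ atoms B
atoms (A ∨ B)  = atoms A ++ atoms B

module _ (v : ℕ → Bool) where

  True : VarPred Γ
  True {A = A} _ = eval v A ≡ true

  true-∷ : (d : Ded (B ∷ Γ) C) → eval v B ≡ true →
    (∀ {A} (x : A ∈ Γ) → Occurs (there x) d → eval v A ≡ true) → OccursOnly True d
  true-∷ d b h (here refl) _ = b
  true-∷ d b h (there x)   o = h x o

  -- Truth is asked only of assumptions that occur, which later confines the normal deduction to
  -- these. `TR` and `¬I` hold by excluded middle: the one of the two discharged formulas that is
  -- true selects the premise to follow.
  soundness : (d : Ded Γ C) → OccursOnly True d → eval v C ≡ true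
  soundness (ass x) h = h x refl
  soundness (∧I {A} {B} d₁ d₂ d₃) h = soundness d₃ (true-∷ d₃ a∧b λ x → h x ∘ inj₂ ∘ inj₂)
    where
    a∧b : eval v (A ∧ B) ≡ true
    a∧b rewrite soundness d₁ (λ x → h x ∘ inj₁) = soundness d₂ (λ x → h x ∘ inj₂ ∘ inj₁)
  soundness (∧E {A} {B} d₁ d₂) h
    with eval v A in a | eval v B in b | soundness d₁ (λ x → h x ∘ inj₁)
  ... | true | true | _ = soundness d₂ λ where
    (here refl) _         → a
    (there (here refl)) _ → b
    (there (there x)) o   → h x (inj₂ o)
  soundness (∨I₁ {A} {B} d₁ d₂) h = soundness d₂ (true-∷ d₂ a∨b λ x → h x ∘ inj₂)
    where
    a∨b : eval v (A ∨ B) ≡ true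
    a∨b rewrite soundness d₁ (λ x → h x ∘ inj₁) = refl
  soundness (∨I₂ {A} {B} d₁ d₂) h = soundness d₂ (true-∷ d₂ a∨b λ x → h x ∘ inj₂)
    where
    a∨b : eval v (A ∨ B) ≡ true
    a∨b with eval v A
    ... | true  = refl
    ... | false = soundness d₁ (λ x → h x ∘ inj₁)
  soundness (∨E {A} {B} d₁ d₂ d₃) h with eval v A in a | soundness d₁ (λ x → h x ∘ inj₁)
  ... | true  | _ = soundness d₂ (true-∷ d₂ a λ x → h x ∘ inj₂ ∘ inj₁)
  ... | false | b = soundness d₃ (true-∷ d₃ b λ x → h x ∘ inj₂ ∘ inj₂)
  soundness (⊃I {A} {B} d₁ d₂) h = soundness d₂ (true-∷ d₂ a⊃b λ x → h x ∘ inj₂)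
    where
    a⊃b : eval v (A ⊃ B) ≡ true
    a⊃b with eval v A
    ... | false = refl
    ... | true  = soundness d₁ (λ x → h x ∘ inj₁)
  soundness (TR {A} {B} d₁ d₂) h with eval v A in a
  ... | true  = soundness d₁ (true-∷ d₁ a λ x → h x ∘ inj₁)
  ... | false = soundness d₂ (true-∷ d₂ (cong (λ u → Bool.not u Bool.∨ eval v B) a) λ x → h x ∘ inj₂)
  soundness (⊃E {A} {B} d₁ d₂ d₃) h
    with eval v A | soundness d₁ (λ x → h x ∘ inj₁) | soundness d₂ (λ x → h x ∘ inj₂ ∘ inj₁)
  ... | true | b | _ = soundness d₃ (true-∷ d₃ b λ x → h x ∘ inj₂ ∘ inj₂)
  soundness (¬I {A} d₁ d₂) h with eval v A in a
  ... | true  = soundness d₁ (true-∷ d₁ a λ x → h x ∘ inj₁)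
  ... | false = soundness d₂ (true-∷ d₂ (cong Bool.not a) λ x → h x ∘ inj₂)
  soundness (¬E {A} d₁ d₂) h
    with eval v A | soundness d₁ (λ x → h x ∘ inj₁) | soundness d₂ (λ x → h x ∘ inj₂)
  ... | true  | () | _
  ... | false | _  | ()

-- Normal deductions over tagged contexts

record World : Set where
  constructor ⟨_,_⟩
  field
    ctx  : List Form
    tags : Tags ctx

open World

infixr 5 _∷[_]_

_∷[_]_ : Form → Bool → World → World
A ∷[ b ] w = ⟨ A ∷ ctx w , b ▸ tags w ⟩

-- Accessibility in the manner of a Kripke model: assumptions may be added, but tags never change,
-- so what can be eliminated stays eliminable.
record _≼_ (w w′ : World) : Set where
  field
    embed     : ∀ {A} → A ∈ ctx w → A ∈ ctx w′
    embed-tag : ∀ {A} (x : A ∈ ctx w) → tags w′ (embed x) ≡ tags w x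

open _≼_

private variable
  w w₁ w₂ w₃ : World

≼-refl : w ≼ w
≼-refl .embed x     = x
≼-refl .embed-tag x = refl

≼-trans : w₁ ≼ w₂ → w₂ ≼ w₃ → w₁ ≼ w₃
≼-trans s s′ .embed x     = embed s′ (embed s x)
≼-trans s s′ .embed-tag x = trans (embed-tag s′ (embed s x)) (embed-tag s x)

≼-step : ∀ {b} → w ≼ (A ∷[ b ] w)
≼-step .embed x     = there x
≼-step .embed-tag x = refl

-- By `okMajor-ass` and `ass-okMajor`, these are exactly the possible major premises in a normal
-- deduction.
Eliminable : World → Form → Set
Eliminable w A = Σ (A ∈ ctx w) λ x → tags w x ≡ false

eliminable-mono : w₁ ≼ w₂ → Eliminable w₁ A → Eliminable w₂ A
eliminable-mono s (x , e) = embed s x , trans (embed-tag s x) e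

NormalDed : World → Form → Set
NormalDed w C = Σ (Ded (ctx w) C) λ d → WF d × NormalT (tags w) d

-- If the new assumption does not occur, the premise already deduces `C` after strengthening and the
-- rule is left out; otherwise `k` applies the rule. The continuation form lets rules with two
-- discharging premises nest it.
discharge : ∀ {b} → NormalDed (A ∷[ b ] w) C →
  ((d : Ded (A ∷ ctx w) C) → WF d → NormalT (b ▸ tags w) d → Occurs (here refl) d →
    NormalDed w C) →
  NormalDed w C
discharge {A} {w} {C} {b} (d , wf , n) k with occurs? (here refl) d
... | yes o = k d wf n o
... | no ¬o = rename d ρ , rename-WF d ρ wf , rename-normal d ρ e n
  where
  ρ : Renaming d (ctx w)
  ρ (here refl) o = ⊥-elim (¬o o)
  ρ (there x)   _ = x
  e : PreservesTags (b ▸ tags w) (tags w) d ρ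
  e (here refl) o = ⊥-elim (¬o o)
  e (there x)   _ = refl

-- Rules applied to assumptions, without vacuous discharge

∧I-ass : A ∈ ctx w → B ∈ ctx w → NormalDed ((A ∧ B) ∷[ true ] w) C → NormalDed w C
∧I-ass x y m = discharge m λ d wf n o →
  ∧I (ass x) (ass y) d , (tt , tt , wf , o) , tt , tt , n

-- One discharged conjunct is enough for the convention, so the rule is left out only when neither
-- occurs.
∧E-ass : Eliminable w (A ∧ B) → NormalDed (A ∷[ false ] B ∷[ false ] w) C → NormalDed w C
∧E-ass {w} {A} {B} (x , e) (d , wf , n)
  with occurs? (here refl) d | occurs? (there (here refl)) d
... | yes o | _     = ∧E (ass x) d , (tt , wf , inj₁ o) , ass-okMajor (tags w) e , tt , n
... | no _  | yes o = ∧E (ass x) d , (tt , wf , inj₂ o) , ass-okMajor (tags w) e , tt , n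
... | no ¬a | no ¬b = rename d ρ , rename-WF d ρ wf , rename-normal d ρ ρ-tags n
  where
  ρ : Renaming d (ctx w)
  ρ (here refl)         o = ⊥-elim (¬a o)
  ρ (there (here refl)) o = ⊥-elim (¬b o)
  ρ (there (there x))   _ = x
  ρ-tags : PreservesTags (false ▸ (false ▸ tags w)) (tags w) d ρ
  ρ-tags (here refl)         o = ⊥-elim (¬a o)
  ρ-tags (there (here refl)) o = ⊥-elim (¬b o)
  ρ-tags (there (there x))   _ = refl

∨I₁-ass : A ∈ ctx w → NormalDed ((A ∨ B) ∷[ true ] w) C → NormalDed w C
∨I₁-ass x m = discharge m λ d wf n o → ∨I₁ (ass x) d , (tt , wf , o) , tt , n

∨I₂-ass : B ∈ ctx w → NormalDed ((A ∨ B) ∷[ true ] w) C → NormalDed w C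
∨I₂-ass x m = discharge m λ d wf n o → ∨I₂ (ass x) d , (tt , wf , o) , tt , n

∨E-ass : Eliminable w (A ∨ B) →
  NormalDed (A ∷[ false ] w) C → NormalDed (B ∷[ false ] w) C → NormalDed w C
∨E-ass {w} (x , e) m₁ m₂ =
  discharge m₁ λ d₁ wf₁ n₁ o₁ → discharge m₂ λ d₂ wf₂ n₂ o₂ →
  ∨E (ass x) d₁ d₂ , (tt , wf₁ , wf₂ , o₁ , o₂) , ass-okMajor (tags w) e , tt , n₁ , n₂

⊃I-ass : B ∈ ctx w → NormalDed ((A ⊃ B) ∷[ true ] w) C → NormalDed w C
⊃I-ass x m = discharge m λ d wf n o → ⊃I (ass x) d , (tt , wf , o) , tt , n

TR-ass : NormalDed (A ∷[ false ] w) C → NormalDed ((A ⊃ B) ∷[ true ] w) C → NormalDed w C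
TR-ass m₁ m₂ =
  discharge m₁ λ d₁ wf₁ n₁ o₁ → discharge m₂ λ d₂ wf₂ n₂ o₂ →
  TR d₁ d₂ , (wf₁ , wf₂ , o₁ , o₂) , n₁ , n₂

⊃E-ass : Eliminable w (A ⊃ B) → A ∈ ctx w → NormalDed (B ∷[ false ] w) C → NormalDed w C
⊃E-ass {w} (x , e) y m = discharge m λ d wf n o →
  ⊃E (ass x) (ass y) d , (tt , tt , wf , o) , ass-okMajor (tags w) e , tt , tt , n

¬I-ass : NormalDed (A ∷[ false ] w) C → NormalDed ((¬' A) ∷[ true ] w) C → NormalDed w C
¬I-ass m₁ m₂ =
  discharge m₁ λ d₁ wf₁ n₁ o₁ → discharge m₂ λ d₂ wf₂ n₂ o₂ →
  ¬I d₁ d₂ , (wf₁ , wf₂ , o₁ , o₂) , n₁ , n₂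

¬E-ass : Eliminable w (¬' A) → A ∈ ctx w → NormalDed w C
¬E-ass {w} (x , e) y = ¬E (ass x) (ass y) , (tt , tt) , ass-okMajor (tags w) e , tt , tt

-- Completeness of normal deductions

module Completeness (C : Form) where

  -- Negation with the goal `C` in place of falsity, stable under growth of the world.
  Refutable : World → Form → Set
  Refutable w A = ∀ {w′} → w ≼ w′ → Eliminable w′ A → NormalDed w′ C

  -- Stronger than `Refutable`, since `A` may bear either tag: it may be the major assumption of an
  -- introduction, which must not be eliminated.
  Suffices : World → Form → Set
  Suffices w A = ∀ {w′} → w ≼ w′ → A ∈ ctx w′ → NormalDed w′ C

  module _ (v : ℕ → Bool) where

    Decided : World → ℕ → Set
    Decided w p = (v p ≡ true → Eliminable w (atom p)) × (v p ≡ false → Refutable w (atom p))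

    AtomsDecided : World → Form → Set
    AtomsDecided w A = ∀ {p} → p ∈ atoms A → Decided w p

    decided-mono : w₁ ≼ w₂ → AtomsDecided w₁ A → AtomsDecided w₂ A
    decided-mono s l i with l i
    ... | t , f = (λ e → eliminable-mono s (t e)) , λ e s′ → f e (≼-trans s s′)

    -- Stated for the concatenation, so that it serves `⊃`, `∧` and `∨` alike.
    decidedˡ : ∀ {w} A {B} → (∀ {p} → p ∈ atoms A ++ atoms B → Decided w p) → AtomsDecided w A
    decidedˡ _ l i = l (∈-++⁺ˡ i)

    decidedʳ : ∀ {w} A {B} → (∀ {p} → p ∈ atoms A ++ atoms B → Decided w p) → AtomsDecided w B
    decidedʳ A l i = l (∈-++⁺ʳ (atoms A) i)

    -- Mutual induction with `refute`. General introduction rules do not conclude the introduced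
    -- formula but provide it as an assumption, hence the continuation in an extended world.
    introduce : ∀ A {w} → AtomsDecided w A → eval v A ≡ true → Suffices w A → NormalDed w C
    -- Falsity descends to the components: those discharged by an elimination rule are tagged
    -- `false` and can be eliminated in turn. A true antecedent or negated formula is introduced
    -- first and serves as minor premise.
    refute    : ∀ A {w} → AtomsDecided w A → eval v A ≡ false → Eliminable w A → NormalDed w C

    introduce (atom p) l e k with l (here refl)
    ... | t , _ with t e
    ...   | x , _ = k ≼-refl x
    introduce (¬' A) l e k with eval v A in a
    -- `A`, discharged in the first premise, has tag `false` and may be eliminated; `¬' A`, tagged
    -- `true`, is only handed to `k`. The `TR` case below works in the same way.
    ... | false = ¬I-ass (refute A (decided-mono {A = A} ≼-step l) a (here refl , refl))
                         (k ≼-step (here refl))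
    introduce (A ⊃ B) l e k with eval v A in a
    ... | false = TR-ass (refute A (decided-mono {A = A} ≼-step (decidedˡ A {B} l)) a (here refl , refl))
                         (k ≼-step (here refl))
    ... | true  = introduce B (decidedʳ A {B} l) e λ s x →
      ⊃I-ass x (k (≼-trans s ≼-step) (here refl))
    introduce (A ∧ B) l e k with eval v A in a
    ... | true  = introduce A (decidedˡ A {B} l) a λ s x →
      introduce B (decided-mono {A = B} s (decidedʳ A {B} l)) e λ s′ y →
      ∧I-ass (embed s′ x) y (k (≼-trans s (≼-trans s′ ≼-step)) (here refl))
    introduce (A ∨ B) l e k with eval v A in a
    ... | true  = introduce A (decidedˡ A {B} l) a λ s x →
      ∨I₁-ass x (k (≼-trans s ≼-step) (here refl))
    ... | false = introduce B (decidedʳ A {B} l) e λ s x →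
      ∨I₂-ass x (k (≼-trans s ≼-step) (here refl))

    refute (atom p) l e u with l (here refl)
    ... | _ , f = f e ≼-refl u
    refute (¬' A) l e u with eval v A in a
    ... | true  = introduce A l a λ s x → ¬E-ass (eliminable-mono s u) x
    refute (A ⊃ B) l e u with eval v A in a
    ... | true  = introduce A (decidedˡ A {B} l) a λ s x →
      ⊃E-ass (eliminable-mono s u) x
        (refute B (decided-mono {A = B} (≼-trans s ≼-step) (decidedʳ A {B} l)) e (here refl , refl))
    refute (A ∧ B) l e u with eval v A in a
    ... | false = ∧E-ass u
      (refute A (decided-mono {A = A} (≼-trans ≼-step ≼-step) (decidedˡ A {B} l)) a (here refl , refl))
    ... | true  = ∧E-ass u
      (refute B (decided-mono {A = B} (≼-trans ≼-step ≼-step) (decidedʳ A {B} l)) e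
        (there (here refl) , refl))
    refute (A ∨ B) l e u with eval v A in a
    ... | false = ∨E-ass u
      (refute A (decided-mono {A = A} ≼-step (decidedˡ A {B} l)) a (here refl , refl))
      (refute B (decided-mono {A = B} ≼-step (decidedʳ A {B} l)) e (here refl , refl))

  -- Running through the valuations of the atoms

  module _ (Δ : List Form)
    (valid : ∀ v → (∀ {A} → A ∈ Δ → eval v A ≡ true) → eval v C ≡ true) where

    support : List ℕ
    support = concatMap atoms (C ∷ Δ)

    start-world : World
    start-world = ⟨ Δ , (λ _ → false) ⟩

    -- If `C` is true, it is introduced and the leaf so obtained is the whole continuation. If not,
    -- validity yields a false member of `Δ`, which is refuted.
    decide : ∀ v → start-world ≼ w → (∀ {p} → p ∈ support → Decided v w p) → NormalDed w C
    decide v s l with eval v C in c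
    ... | true  = introduce v C (λ i → l (∈-++⁺ˡ i)) c λ _ x → ass x , tt , tt
    ... | false with all? (λ A → eval v A Bool.≟ true) Δ
    ...   | yes h = contradiction (trans (sym c) (valid v (lookup h))) λ ()
    ...   | no ¬h with find (¬All⇒Any¬ (λ A → eval v A Bool.≟ true) Δ ¬h)
    ...     | A , x , ¬a = refute v A
                (λ i → l (∈-++⁺ʳ (atoms C) (∈-concatMap⁺ atoms (Any.map (λ { refl → i }) x))))
                (¬-not ¬a) (embed s x , embed-tag s x)

    split : (todo trues : List ℕ) → start-world ≼ w →
      (∀ {p} → p ∈ trues → Eliminable w (atom p)) →
      (∀ {p} → p ∈ support → p ∈ todo ⊎ p ∈ trues ⊎ Refutable w (atom p)) →
      NormalDed w C
    split {w} [] trues s t cover = decide v s decided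
      where
      v : ℕ → Bool
      -- The support may list an atom twice, which can then be both in `trues` and refutable; being
      -- in `trues` takes precedence.
      v p = does (p ∈? trues)
      decided : ∀ {p} → p ∈ support → Decided v w p
      decided {p} i with p ∈? trues | cover i
      ... | yes j | _             = (λ _ → t j) , λ ()
      ... | no ¬j | inj₂ (inj₁ j) = contradiction j ¬j
      ... | no ¬j | inj₂ (inj₂ f) = (λ ()) , λ _ → f
    split {w} (q ∷ todo) trues s t cover = split todo trues s t coverᶠ
      where
      coverᵗ : ∀ {w′} → w ≼ w′ → ∀ {p} → p ∈ support →
        p ∈ todo ⊎ p ∈ q ∷ trues ⊎ Refutable w′ (atom p)
      coverᵗ s′ i with cover i
      ... | inj₁ (here refl) = inj₂ (inj₁ (here refl))
      ... | inj₁ (there j)   = inj₁ j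
      ... | inj₂ (inj₁ j)    = inj₂ (inj₁ (there j))
      ... | inj₂ (inj₂ f)    = inj₂ (inj₂ λ s″ → f (≼-trans s′ s″))
      q-refutable : Refutable w (atom q)
      -- The branch where `q` is true is run inside the refutation, in whatever world supplies `q`
      -- as an assumption.
      q-refutable s′ u = split todo (q ∷ trues) (≼-trans s s′)
        (λ { (here refl) → u ; (there j) → eliminable-mono s′ (t j) }) (coverᵗ s′)
      coverᶠ : ∀ {p} → p ∈ support → p ∈ todo ⊎ p ∈ trues ⊎ Refutable w (atom p)
      coverᶠ i with cover i
      ... | inj₁ (here refl) = inj₂ (inj₂ q-refutable)
      ... | inj₁ (there j)   = inj₁ j
      ... | inj₂ c           = inj₂ c

    completeness : NormalDed start-world C
    completeness = split support [] ≼-refl (λ ()) inj₁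

open Completeness using (completeness)

-- Restriction to the assumptions in use

record Restriction (Γ : List Form) (P : VarPred Γ) : Set where
  field
    sub       : List Form
    include   : ∀ {A} → A ∈ sub → A ∈ Γ
    include-P : ∀ {A} (x : A ∈ sub) → P (include x)
    restrict  : ∀ {A} (x : A ∈ Γ) → P x → A ∈ sub

open Restriction

restriction : (P : VarPred Γ) → (∀ {A} (x : A ∈ Γ) → Dec (P x)) → Restriction Γ P
restriction {[]} P P? = record
  { sub = [] ; include = λ () ; include-P = λ () ; restrict = λ () }
restriction {B ∷ Γ} P P? with restriction (P ∘ there) (P? ∘ there) | P? (here refl)
... | r | no ¬p = record
  { sub       = sub r
  ; include   = λ x → there (include r x)
  ; include-P = include-P r
  ; restrict  = λ { (here refl) p → contradiction p ¬p ; (there x) p → restrict r x p }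
  }
... | r | yes p = record
  { sub       = B ∷ sub r
  ; include   = λ { (here e) → here e ; (there x) → there (include r x) }
  ; include-P = λ { (here refl) → p ; (there x) → include-P r x }
  ; restrict  = λ { (here e) _ → here e ; (there x) p → there (restrict r x p) }
  }

theorem2 : ∀ {Γ : List Form} {C : Form} (d : Ded Γ C) → WF d →
    Σ (Ded Γ C) λ d′ → WF d′ × Normal d′ ×
    (∀ {A} (x : A ∈ Γ) → Occurs x d′ → Occurs x d)
theorem2 {Γ} {C} d _ with restriction (λ x → Occurs x d) (λ x → occurs? x d)
... | r with completeness C (sub r) (λ v h → soundness v d λ x o → h (restrict r x o))
...   | d₀ , wf , n =
  -- The normal deduction is carried back into `Γ`. All tags outside it are `false` on both sides,
  -- and `include` reaches only positions occurring in `d`.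
  rename d₀ ρ , rename-WF d₀ ρ wf , rename-normal d₀ ρ (λ _ _ → refl) n ,
  rename-occursOnly (λ x → Occurs x d) d₀ ρ (λ x _ → include-P r x)
  where
  ρ : Renaming d₀ Γ
  ρ x _ = include r x
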